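{- Let $\mathbb{M}$ be a complete MV-chain, let $Y, Z$ be finite sets, let $f:\mathbb{M}^Y\to\mathbb{M}^Z$ be a non-expansive function and let $a\in\mathbb{M}^Y$. Then for all $\delta\in\mathbb{M}$ with $0\sqsubset\delta$: (a) $\gamma_{f(a),\delta}\circ f\subseteq f_a^{\#}\circ\gamma_{a,\delta}$, i.e. $\gamma_{f(a),\delta}(f(b))\subseteq f_a^{\#}(\gamma_{a,\delta}(b))$ for all $b\in[a,a\oplus\delta]$; (b) if $\delta\sqsubseteq\delta_a$, then $\delta\sqsubseteq\iota_a^f$ if and only if $\gamma_{f(a),\delta}\circ f=f_a^{\#}\circ\gamma_{a,\delta}$ as functions on $[a,a\oplus\delta]$.
   Context: MV-algebras: an MV-algebra is a tuple $\mathbb{M}=(M,\oplus,0,\overline{(\cdot)})$ where $(M,\oplus,0)$ is a commutative monoid and $\overline{(\cdot)}:M\to M$ satisfies $\overline{\overline{x}}=x$, $x\oplus\overline{0}=\overline{0}$ and $\overline{(\overline{x}\oplus y)}\oplus y=\overline{(\overline{y}\oplus x)}\oplus x$ for all $x,y$. Put $1=\overline{0}$, $x\otimes y=\overline{\overline{x}\oplus\overline{y}}$, $x\ominus y=x\otimes\overline{y}$. The natural order is $x\sqsubseteq y$ iff $x\oplus z=y$ for some $z$; it is a lattice order with bottom $0$ and top $1$; $x\sqsubset y$ means $x\sqsubseteq y$ and $x\neq y$. $\mathbb{M}$ is an MV-chain if $\sqsubseteq$ is total, and complete if $(M,\sqsubseteq)$ is a complete lattice. Function spaces: $\mathbb{M}^Y$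 is the set of functions $Y\to M$ with pointwise order and operations; $[b,c]=\{d\mid b\sqsubseteq d\sqsubseteq c\}$. For $Y'\subseteq Y$, $\delta\in\mathbb{M}$, $\delta_{Y'}$ is the function with value $\delta$ on $Y'$ and $0$ elsewhere; $\delta$ also denotes the constant function $\delta_Y$. The norm is $\|a\|=\max\{a(y)\mid y\in Y\}$. A function $f:\mathbb{M}^Y\to\mathbb{M}^Z$ is non-expansive if $\|f(b)\ominus f(a)\|\sqsubseteq\|b\ominus a\|$ for all $a,b\in\mathbb{M}^Y$. Such $f$ is monotone and maps $[a,a\oplus\delta]$ into $[f(a),f(a)\oplus\delta]$. Approximations: for $a\in\mathbb{M}^Y$ let $[Y]_a=\{y\in Y\mid a(y)\neq 1\}$ and $\delta_a=\min\{\overline{a(y)}\mid y\in[Y]_a\}$ with $\min\emptyset=1$. For $\delta\in\mathbb{M}$ let $\alpha_{a,\delta}:\mathbf{2}^{[Y]_a}\to[a,a\oplus\delta]$, $\alpha_{a,\delta}(Y')=a\oplus\delta_{Y'}$, and $\gamma_{a,\delta}:[a,a\oplus\delta]\to\mathbf{2}^{[Y]_a}$, $\gamma_{a,\delta}(b)=\{y\in[Y]_a\mid b(y)\ominus a(y)\sqsupseteq\delta\}$; $\gamma_{f(a),\delta}$ is defined likewise for $f(a)\in\mathbb{M}^Z$. For non-expansive $f$ put $f_{a,\delta}^{\#}=\gamma_{f(a),\delta}\circ f\circ\alpha_{a,\delta}:\mathbf{2}^{[Y]_a}\to\mathbf{2}^{[Z]_{f(a)}}$. For $Y'\subseteq[Y]_a$,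 $z\in[Z]_{f(a)}$ let $\iota_a^f(Y',z)=\max\{\theta\in\mathbb{M}\mid z\in f_{a,\theta}^{\#}(Y')\}$ (the maximum exists when $\mathbb{M}$ is a complete MV-chain), and $\iota_a^f=\min\big(\{\iota_a^f(Y',z)\mid Y'\subseteq[Y]_a,\ z\in[Z]_{f(a)},\ \iota_a^f(Y',z)\neq 0\}\cup\{\delta_a\}\big)$. The $a$-approximation of $f$ is $f_a^{\#}=f_{a,\iota_a^f}^{\#}$. -}

module Defs where

open import Level using (Level; _⊔_; suc; Lift; lift; lower)
open import Algebra.Core using (Op₁; Op₂)
open import Algebra.Definitions using (Congruent₁; Involutive; RightZero)
open import Algebra.Structures using (IsCommutativeMonoid)
open import Axiom.ExcludedMiddle using (ExcludedMiddle)
open import Data.Bool.Base using (if_then_else_)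
open import Data.Fin.Base using (Fin)
open import Data.Fin.Subset using (Subset; inside; outside; _∈_; _⊆_)
open import Data.Fin.Subset.Properties using (_∈?_; _⊆?_)
open import Data.List.Base as List using (List; []; _∷_; _++_)
import Data.List.Extrema as Extrema
import Data.List.Membership.Propositional as List
import Data.List.Membership.Propositional.Properties as List
import Data.List.Relation.Unary.All as All
import Data.List.Relation.Unary.All.Properties as All
open import Data.List.Relation.Unary.Any using (here)
open import Data.Nat.Base as ℕ using (ℕ)
open import Data.Product.Base using (∃; _×_; _,_; proj₁; proj₂; uncurry)
open import Data.Sum.Base using (inj₁; inj₂)
open import Data.Vec.Base as Vec using ([]; _∷_; lookup)
open import Data.Vec.Functional using (Vector; zipWith)
open import Data.Vec.Functional.Relation.Binary.Pointwise using (Pointwise)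
open import Data.Vec.Properties using (lookup∘tabulate; lookup⇒[]=; []=⇒lookup)
open import Function.Base using (_∘_)
open import Relation.Binary.Bundles using (Setoid; TotalOrder)
open import Relation.Binary.Core using (Rel)
open import Relation.Binary.Definitions using (Decidable; Total)
open import Relation.Binary.PropositionalEquality as ≡ using (_≡_)
import Relation.Binary.Reasoning.Setoid as ≈-Reasoning
open import Relation.Nullary.Decidable as Dec using (Dec; does; yes; no; ¬?; _×-dec_)
open import Relation.Nullary.Negation using (¬_)
import Relation.Unary as U
open U using (Pred)

record MVAlgebra c ℓ : Set (suc (c ⊔ ℓ)) where
  infix  4 _≈_ _⊑_ _⊏_
  infixl 6 _⊕_ _⊖_
  infixl 7 _⊗_
  infix  8 ∼_
  field
    Carrier             : Set c
    _≈_                 : Rel Carrier ℓ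
    _⊕_                 : Op₂ Carrier
    0#                  : Carrier
    ∼_                  : Op₁ Carrier
    isCommutativeMonoid : IsCommutativeMonoid _≈_ _⊕_ 0#
    ∼-cong              : Congruent₁ _≈_ ∼_
    ∼-involutive        : Involutive _≈_ ∼_
    ⊕-zeroʳ             : RightZero _≈_ (∼ 0#) _⊕_
    ∼-⊕-swap            : ∀ x y → ∼ (∼ x ⊕ y) ⊕ y ≈ ∼ (∼ y ⊕ x) ⊕ x

  1# : Carrier
  1# = ∼ 0#

  _⊗_ : Op₂ Carrier
  x ⊗ y = ∼ (∼ x ⊕ ∼ y)

  _⊖_ : Op₂ Carrier
  x ⊖ y = x ⊗ ∼ y

  _⊑_ : Rel Carrier (c ⊔ ℓ)
  x ⊑ y = ∃ λ z → x ⊕ z ≈ y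

  _⊏_ : Rel Carrier (c ⊔ ℓ)
  x ⊏ y = x ⊑ y × ¬ (x ≈ y)

module _ {c ℓ} (M : MVAlgebra c ℓ) where
  open MVAlgebra M

  IsSupremum : ∀ {p} → Pred Carrier p → Pred Carrier (c ⊔ ℓ ⊔ p)
  IsSupremum S s = (∀ {x} → S x → x ⊑ s) × (∀ {u} → (∀ {x} → S x → x ⊑ u) → s ⊑ u)

  IsInfimum : ∀ {p} → Pred Carrier p → Pred Carrier (c ⊔ ℓ ⊔ p)
  IsInfimum S s = (∀ {x} → S x → s ⊑ x) × (∀ {u} → (∀ {x} → S x → u ⊑ x) → u ⊑ s)

  IsMaximum : ∀ {p} → Pred Carrier p → Pred Carrier (c ⊔ ℓ ⊔ p)
  IsMaximum S s = S s × (∀ {x} → S x → x ⊑ s)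

  IsComplete : Set (suc (c ⊔ ℓ))
  IsComplete = (S : Pred Carrier (c ⊔ ℓ)) → ∃ (IsSupremum S) × ∃ (IsInfimum S)

record CompleteMVChain c ℓ : Set (suc (c ⊔ ℓ)) where
  field
    mvAlgebra : MVAlgebra c ℓ
  open MVAlgebra mvAlgebra public
  field
    ⊑-total    : Total _⊑_
    ⊑-complete : IsComplete mvAlgebra

module MVAlgebraProperties {c ℓ} (M : MVAlgebra c ℓ) where
  open MVAlgebra M
  open IsCommutativeMonoid isCommutativeMonoid public
    using (refl; sym; trans; assoc; comm; identityˡ; identityʳ; isEquivalence)
    renaming (∙-congˡ to ⊕-congˡ; ∙-congʳ to ⊕-congʳ; ∙-cong to ⊕-cong)

  ≈-setoid : Setoid c ℓ
  ≈-setoid = record { isEquivalence = isEquivalence }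

  open ≈-Reasoning ≈-setoid

  ∼1≈0 : ∼ 1# ≈ 0#
  ∼1≈0 = ∼-involutive 0#

  ⊕-zeroˡ : ∀ x → 1# ⊕ x ≈ 1#
  ⊕-zeroˡ x = trans (comm 1# x) (⊕-zeroʳ x)

  ⊕-complementˡ : ∀ x → ∼ x ⊕ x ≈ 1#
  ⊕-complementˡ x = begin
    ∼ x ⊕ x            ≈⟨ ⊕-congʳ (∼-cong (trans (⊕-congʳ ∼1≈0) (identityˡ x))) ⟨
    ∼ (∼ 1# ⊕ x) ⊕ x   ≈⟨ ∼-⊕-swap x 1# ⟨
    ∼ (∼ x ⊕ 1#) ⊕ 1#  ≈⟨ ⊕-zeroʳ _ ⟩
    1#                 ∎

  ∼1⊕ : ∀ {u} x → u ≈ 1# → ∼ u ⊕ x ≈ x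
  ∼1⊕ {u} x u≈1 = begin
    ∼ u ⊕ x   ≈⟨ ⊕-congʳ (∼-cong u≈1) ⟩
    ∼ 1# ⊕ x  ≈⟨ ⊕-congʳ ∼1≈0 ⟩
    0# ⊕ x    ≈⟨ identityˡ x ⟩
    x         ∎

  ⊑⇒≈1 : ∀ {x y} → x ⊑ y → ∼ x ⊕ y ≈ 1#
  ⊑⇒≈1 {x} {y} (z , x⊕z≈y) = begin
    ∼ x ⊕ y        ≈⟨ ⊕-congˡ x⊕z≈y ⟨
    ∼ x ⊕ (x ⊕ z)  ≈⟨ assoc _ _ _ ⟨
    ∼ x ⊕ x ⊕ z    ≈⟨ ⊕-congʳ (⊕-complementˡ x) ⟩
    1# ⊕ z         ≈⟨ ⊕-zeroˡ z ⟩
    1#             ∎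

  ≈1⇒⊑ : ∀ {x y} → ∼ x ⊕ y ≈ 1# → x ⊑ y
  ≈1⇒⊑ {x} {y} h = ∼ (∼ y ⊕ x) , (begin
    x ⊕ ∼ (∼ y ⊕ x)  ≈⟨ comm _ _ ⟩
    ∼ (∼ y ⊕ x) ⊕ x  ≈⟨ ∼-⊕-swap x y ⟨
    ∼ (∼ x ⊕ y) ⊕ y  ≈⟨ ∼1⊕ y h ⟩
    y                ∎)

  ⊑-reflexive : ∀ {x y} → x ≈ y → x ⊑ y
  ⊑-reflexive x≈y = 0# , trans (identityʳ _) x≈y

  ⊑-trans : ∀ {x y z} → x ⊑ y → y ⊑ z → x ⊑ z
  ⊑-trans (u , p) (v , q) = u ⊕ v , trans (sym (assoc _ _ _)) (trans (⊕-congʳ p) q)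

  ⊑-antisym : ∀ {x y} → x ⊑ y → y ⊑ x → x ≈ y
  ⊑-antisym {x} {y} x⊑y y⊑x = begin
    x                ≈⟨ ∼1⊕ x (⊑⇒≈1 y⊑x) ⟨
    ∼ (∼ y ⊕ x) ⊕ x  ≈⟨ ∼-⊕-swap x y ⟨
    ∼ (∼ x ⊕ y) ⊕ y  ≈⟨ ∼1⊕ y (⊑⇒≈1 x⊑y) ⟩
    y                ∎

  0⊑ : ∀ x → 0# ⊑ x
  0⊑ x = x , identityˡ x

  ∼-antitone : ∀ {x y} → x ⊑ y → ∼ y ⊑ ∼ x
  ∼-antitone {x} {y} x⊑y = ≈1⇒⊑ (begin
    ∼ ∼ y ⊕ ∼ x  ≈⟨ ⊕-congʳ (∼-involutive y) ⟩
    y ⊕ ∼ x      ≈⟨ comm _ _ ⟩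
    ∼ x ⊕ y      ≈⟨ ⊑⇒≈1 x⊑y ⟩
    1#           ∎)

  ⊕-monoˡ : ∀ z {x y} → x ⊑ y → x ⊕ z ⊑ y ⊕ z
  ⊕-monoˡ z {x} {y} (u , p) = u , (begin
    x ⊕ z ⊕ u    ≈⟨ assoc _ _ _ ⟩
    x ⊕ (z ⊕ u)  ≈⟨ ⊕-congˡ (comm z u) ⟩
    x ⊕ (u ⊕ z)  ≈⟨ assoc _ _ _ ⟨
    x ⊕ u ⊕ z    ≈⟨ ⊕-congʳ p ⟩
    y ⊕ z        ∎)

  ⊕-monoʳ : ∀ z {x y} → x ⊑ y → z ⊕ x ⊑ z ⊕ y
  ⊕-monoʳ z (u , p) = u , trans (assoc _ _ _) (⊕-congˡ p)

  ⊖-monoˡ : ∀ z {x y} → x ⊑ y → x ⊖ z ⊑ y ⊖ z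
  ⊖-monoˡ z = ∼-antitone ∘ ⊕-monoˡ _ ∘ ∼-antitone

  ⊑⇒⊖≈0 : ∀ {x y} → x ⊑ y → x ⊖ y ≈ 0#
  ⊑⇒⊖≈0 {x} {y} x⊑y = begin
    ∼ (∼ x ⊕ ∼ ∼ y)  ≈⟨ ∼-cong (⊕-congˡ (∼-involutive y)) ⟩
    ∼ (∼ x ⊕ y)      ≈⟨ ∼-cong (⊑⇒≈1 x⊑y) ⟩
    ∼ 1#             ≈⟨ ∼1≈0 ⟩
    0#               ∎

  ⊖⊑0⇒⊑ : ∀ {x y} → x ⊖ y ⊑ 0# → x ⊑ y
  ⊖⊑0⇒⊑ {x} {y} h = ≈1⇒⊑ (begin
    ∼ x ⊕ y              ≈⟨ ⊕-congˡ (∼-involutive y) ⟨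
    ∼ x ⊕ ∼ ∼ y          ≈⟨ ∼-involutive _ ⟨
    ∼ ∼ (∼ x ⊕ ∼ ∼ y)    ≈⟨ ∼-cong (⊑-antisym h (0⊑ _)) ⟩
    1#                   ∎)

fromDec : ∀ {n p} {P : Pred (Fin n) p} → U.Decidable P → Subset n
fromDec P? = Vec.tabulate (does ∘ P?)

module _ {n p} {P : Pred (Fin n) p} (P? : U.Decidable P) where

  ∈-fromDec⁺ : ∀ {i} → P i → i ∈ fromDec P?
  ∈-fromDec⁺ {i} Pi =
    lookup⇒[]= i _ (≡.trans (lookup∘tabulate (does ∘ P?) i) (Dec.dec-true (P? i) Pi))

  ∈-fromDec⁻ : ∀ {i} → i ∈ fromDec P? → P i
  ∈-fromDec⁻ {i} i∈ with P? i | ≡.trans (≡.sym (lookup∘tabulate (does ∘ P?) i)) ([]=⇒lookup i∈)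
  ... | yes Pi | _ = Pi
  ... | no  _  | ()

elements : ∀ {n} → Subset n → List (Fin n)
elements p = List.filter (_∈? p) (List.allFin _)

subsets : ∀ n → List (Subset n)
subsets ℕ.zero    = [] ∷ []
subsets (ℕ.suc n) = List.map (outside ∷_) (subsets n) ++ List.map (inside ∷_) (subsets n)

∈-subsets : ∀ {n} (p : Subset n) → p List.∈ subsets n
∈-subsets []            = here ≡.refl
∈-subsets (outside ∷ p) = List.∈-++⁺ˡ (List.∈-map⁺ _ (∈-subsets p))
∈-subsets {ℕ.suc n} (inside ∷ p) =
  List.∈-++⁺ʳ (List.map (outside ∷_) (subsets n)) (List.∈-map⁺ _ (∈-subsets p))

-- The finite sets Y and Z are Fin m and Fin n.  Excluded middle makes subsets
-- such as [Y]_a and γ_{a,δ}(b) decidable, hence elements of Subset.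
module Approximation {c ℓ} (em : ExcludedMiddle (c ⊔ ℓ)) (𝕄 : CompleteMVChain c ℓ) where
  open CompleteMVChain 𝕄
  open MVAlgebraProperties mvAlgebra

  ⊑-totalOrder : TotalOrder c ℓ (c ⊔ ℓ)
  ⊑-totalOrder = record
    { _≈_          = _≈_
    ; _≤_          = _⊑_
    ; isTotalOrder = record
      { isPartialOrder = record
        { isPreorder = record
          { isEquivalence = isEquivalence
          ; reflexive     = ⊑-reflexive
          ; trans         = ⊑-trans
          }
        ; antisym = ⊑-antisym
        }
      ; total = ⊑-total
      }
    }

  open Extrema ⊑-totalOrder using (min; max; max≤v⁺; xs≤max)

  infix 4 _≈?_ _⊑?_ _⊑̇_ _∈[_,_]

  _≈?_ : Decidable _≈_
  x ≈? y = Dec.map′ lower lift (em {Lift c (x ≈ y)})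

  _⊑?_ : Decidable _⊑_
  x ⊑? y = em

  ⋁ : Pred Carrier (c ⊔ ℓ) → Carrier
  ⋁ S = proj₁ (proj₁ (⊑-complete S))

  _⊑̇_ : ∀ {n} → Rel (Vector Carrier n) (c ⊔ ℓ)
  _⊑̇_ = Pointwise _⊑_

  _∈[_,_] : ∀ {n} → Vector Carrier n → Vector Carrier n → Vector Carrier n → Set (c ⊔ ℓ)
  d ∈[ b , e ] = b ⊑̇ d × d ⊑̇ e

  infixl 6 _⊕̇_ _⊖̇_

  _⊕̇_ _⊖̇_ : ∀ {n} → Op₂ (Vector Carrier n)
  _⊕̇_ = zipWith _⊕_
  _⊖̇_ = zipWith _⊖_

  const : ∀ {n} → Carrier → Vector Carrier n
  const δ _ = δ

  _on_ : ∀ {n} → Carrier → Subset n → Vector Carrier n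
  (δ on Y′) y = if lookup Y′ y then δ else 0#

  -- The norm is 0# on the empty index set.
  ‖_‖ : ∀ {n} → Vector Carrier n → Carrier
  ‖ a ‖ = max 0# (List.tabulate a)

  -- Pointwise-≈ arguments have norm of difference 0, so non-expansiveness already
  -- makes f respect pointwise ≈.
  NonExpansive : ∀ {m n} → (Vector Carrier m → Vector Carrier n) → Set (c ⊔ ℓ)
  NonExpansive f = ∀ a b → ‖ f b ⊖̇ f a ‖ ⊑ ‖ b ⊖̇ a ‖

  -- [Y]_a
  Y[_] : ∀ {n} → Vector Carrier n → Subset n
  Y[ a ] = fromDec (λ y → ¬? (a y ≈? 1#))

  -- δ_a; since 1# is the top element, adding it to the list changes the minimum
  -- only when [Y]_a is empty.
  δ[_] : ∀ {n} → Vector Carrier n → Carrier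
  δ[ a ] = min 1# (List.map (λ y → ∼ a y) (elements Y[ a ]))

  α : ∀ {n} → Vector Carrier n → Carrier → Subset n → Vector Carrier n
  α a δ Y′ = a ⊕̇ (δ on Y′)

  InGamma? : ∀ {n} (a : Vector Carrier n) δ (b : Vector Carrier n) →
             U.Decidable (λ y → y ∈ Y[ a ] × δ ⊑ b y ⊖ a y)
  InGamma? a δ b y = (y ∈? Y[ a ]) ×-dec (δ ⊑? (b y ⊖ a y))

  γ : ∀ {n} → Vector Carrier n → Carrier → Vector Carrier n → Subset n
  γ a δ b = fromDec (InGamma? a δ b)

  module _ {m n} (f : Vector Carrier m → Vector Carrier n) (a : Vector Carrier m) where

    approxAt : Carrier → Subset m → Subset n
    approxAt δ Y′ = γ (f a) δ (f (α a δ Y′))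

    Increases : Subset m → Fin n → Pred Carrier (c ⊔ ℓ)
    Increases Y′ z θ = Lift (c ⊔ ℓ) (z ∈ approxAt θ Y′)

    -- ι_a^f(Y′,z): the supremum is a maximum, see ιAt-isMaximum.
    ιAt : Subset m → Fin n → Carrier
    ιAt Y′ z = ⋁ (Increases Y′ z)

    -- ι_a^f
    ι : Carrier
    ι = min δ[ a ]
          (List.filter (λ θ → ¬? (θ ≈? 0#))
            (List.map (uncurry ιAt)
              (List.cartesianProduct
                (List.filter (_⊆? Y[ a ]) (subsets m))
                (elements Y[ f a ]))))

    -- f_a^#
    approx : Subset m → Subset n
    approx = approxAt ι

  module _ {m n} {f : Vector Carrier m → Vector Carrier n} (f-nonExp : NonExpansive f) where

    nonExpansive⇒monotone : ∀ {a b} → a ⊑̇ b → f a ⊑̇ f b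
    nonExpansive⇒monotone {a} {b} a⊑b z = ⊖⊑0⇒⊑
      (⊑-trans (All.tabulate⁻ (xs≤max 0# (List.tabulate (f a ⊖̇ f b))) z)
        (⊑-trans (f-nonExp b a)
          (max≤v⁺ (0⊑ 0#) (All.tabulate⁺ (λ y → ⊑-reflexive (⊑⇒⊖≈0 (a⊑b y)))))))

    on-mono : ∀ {θ θ′} (Y′ : Subset m) → θ ⊑ θ′ → (θ on Y′) ⊑̇ (θ′ on Y′)
    on-mono Y′ θ⊑θ′ y with lookup Y′ y
    ... | inside  = θ⊑θ′
    ... | outside = 0⊑ 0#

    ιAt-isMaximum : ∀ a Y′ {z} → z ∈ Y[ f a ] →
                    IsMaximum mvAlgebra (Increases f a Y′ z) (ιAt f a Y′ z)
    ιAt-isMaximum a Y′ {z} z∈ =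
      lift (∈-fromDec⁺ (InGamma? (f a) s (f (α a s Y′))) (z∈ , least bound)) , upper
      where
      s = ιAt f a Y′ z
      isSup = proj₂ (proj₁ (⊑-complete (Increases f a Y′ z)))
      upper = proj₁ isSup
      least = proj₂ isSup

      bound : ∀ {θ} → Increases f a Y′ z θ → θ ⊑ f (α a s Y′) z ⊖ f a z
      bound {θ} θ∈ = ⊑-trans
        (proj₂ (∈-fromDec⁻ (InGamma? (f a) θ (f (α a θ Y′))) (lower θ∈)))
        (⊖-monoˡ (f a z) (nonExpansive⇒monotone
          (λ y → ⊕-monoʳ (a y) (on-mono Y′ (upper θ∈) y)) z))

{-# OPTIONS --safe #-}

-- Residuation turns non-expansiveness into: if b ⊑ c ⊕ e pointwise and f(b) exceeds f(a) by δ
-- at z, then f(c) exceeds f(a) by δ ⊖ e at z.  With c = a ⊕ θ_{Y'} and b = a ⊕ θ'_{Y'} this shows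
-- that f^#_{a,θ} is antitone in θ.  With Y' = γ_{a,δ}(b) and e the largest increase b(y) ⊖ a(y)
-- over y ∉ Y', which lies strictly below δ, it shows ι(Y',z) ⊒ δ ⊖ e ≠ 0, whence ι ⊑ ι(Y',z)
-- and (a) follows.  For (b), equality need only be tested at b = a ⊕ δ_{Y'}.
module Submission where

open import Defs
open import Level using (_⊔_; lift; lower)
open import Axiom.ExcludedMiddle using (ExcludedMiddle)
open import Data.Bool.Base using (true; false)
open import Data.Fin.Base using (Fin)
open import Data.Fin.Subset using (Subset; _∈_; _∉_; _⊆_)
open import Data.Fin.Subset.Properties using (_∈?_; _⊆?_; ⊆-antisym)
import Data.List.Base as List
import Data.List.Extrema as Extrema
import Data.List.Membership.Propositional as List
import Data.List.Membership.Propositional.Properties as List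
import Data.List.Relation.Unary.All as All
import Data.List.Relation.Unary.All.Properties as All
open import Data.Nat.Base using (ℕ)
open import Data.Product.Base using (_×_; _,_; proj₁; proj₂; uncurry)
open import Data.Sum.Base using (inj₁; inj₂)
open import Data.Vec.Base using (lookup)
open import Data.Vec.Functional using (Vector)
open import Data.Vec.Properties using (lookup⇒[]=; []=⇒lookup)
open import Function.Base using (_∘_)
open import Function.Bundles using (_⇔_; mk⇔)
open import Relation.Binary.PropositionalEquality as ≡ using (_≡_)
open import Relation.Nullary.Decidable using (yes; no; ¬?)
open import Relation.Nullary.Negation using (¬_; contradiction)

module Residuation {c ℓ} (M : MVAlgebra c ℓ) where
  open MVAlgebra M
  open MVAlgebraProperties M

  -- Because `x ⊑ y` amounts to `∼ x ⊕ y ≈ 1#`, this identity turns both sides of the adjunction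
  -- between `_⊖ y` and `y ⊕_` into one equation.
  ∼⊖⊕≈ : ∀ x y z → ∼ (x ⊖ y) ⊕ z ≈ ∼ x ⊕ (y ⊕ z)
  ∼⊖⊕≈ x y z =
    trans (⊕-congʳ (trans (∼-involutive _) (⊕-congˡ (∼-involutive y)))) (assoc _ _ _)

  ⊖⊑⇒⊑⊕ : ∀ {x y z} → x ⊖ y ⊑ z → x ⊑ y ⊕ z
  ⊖⊑⇒⊑⊕ h = ≈1⇒⊑ (trans (sym (∼⊖⊕≈ _ _ _)) (⊑⇒≈1 h))

  ⊑⊕⇒⊖⊑ : ∀ {x y z} → x ⊑ y ⊕ z → x ⊖ y ⊑ z
  ⊑⊕⇒⊖⊑ h = ≈1⇒⊑ (trans (∼⊖⊕≈ _ _ _) (⊑⇒≈1 h))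

  ⊑-refl : ∀ {x} → x ⊑ x
  ⊑-refl = ⊑-reflexive refl

  x⊑y⊕[x⊖y] : ∀ x y → x ⊑ y ⊕ (x ⊖ y)
  x⊑y⊕[x⊖y] x y = ⊖⊑⇒⊑⊕ ⊑-refl

  x⊑x⊕y : ∀ x y → x ⊑ x ⊕ y
  x⊑x⊕y x y = y , refl

  ⊑⊖⇒⊕⊑ : ∀ {x y z} → x ⊑ y → z ⊑ y ⊖ x → x ⊕ z ⊑ y
  ⊑⊖⇒⊕⊑ {x} {y} {z} x⊑y z⊑y⊖x = ⊑-trans (⊕-monoʳ x z⊑y⊖x)
    -- The round trip through `≈1⇒⊑` exchanges the given witness of `x ⊑ y` for `∼ (∼ y ⊕ x)`, which
    -- is `y ⊖ x`.
    (⊑-reflexive (trans (⊕-congˡ y⊖x≈) (proj₂ (≈1⇒⊑ (⊑⇒≈1 x⊑y)))))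
    where
    y⊖x≈ : y ⊖ x ≈ ∼ (∼ y ⊕ x)
    y⊖x≈ = ∼-cong (⊕-congˡ (∼-involutive x))

  -- The hypothesis rules out truncation of `x ⊕ y` at `1#`. It gives `x ⊑ ∼ y`, hence
  -- `x ⊕ ∼ (x ⊕ y) ≈ ∼ y`, and negating this equation recovers `y`.
  ⊑∼⇒⊑[⊕]⊖ : ∀ {x y} → y ⊑ ∼ x → y ⊑ (x ⊕ y) ⊖ x
  ⊑∼⇒⊑[⊕]⊖ {x} {y} y⊑∼x = ⊑-reflexive (begin
    y                          ≈⟨ ∼-involutive y ⟨
    ∼ ∼ y                      ≈⟨ ∼-cong (proj₂ (≈1⇒⊑ (⊑⇒≈1 x⊑∼y))) ⟨
    ∼ (x ⊕ ∼ (∼ ∼ y ⊕ x))      ≈⟨ ∼-cong (⊕-congˡ (∼-cong (⊕-congʳ (∼-involutive y)))) ⟩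
    ∼ (x ⊕ ∼ (y ⊕ x))          ≈⟨ ∼-cong (⊕-congˡ (∼-cong (comm y x))) ⟩
    ∼ (x ⊕ ∼ (x ⊕ y))          ≈⟨ ∼-cong (comm _ _) ⟩
    ∼ (∼ (x ⊕ y) ⊕ x)          ≈⟨ ∼-cong (⊕-congˡ (∼-involutive x)) ⟨
    (x ⊕ y) ⊖ x                ∎)
    where
    open import Relation.Binary.Reasoning.Setoid ≈-setoid
    x⊑∼y : x ⊑ ∼ y
    x⊑∼y = ⊑-trans (⊑-reflexive (sym (∼-involutive x))) (∼-antitone y⊑∼x)

  -- The sum `(x ⊖ y) ⊕ y` is at most `x` and is not truncated, so `⊑∼⇒⊑[⊕]⊖` applies to `x ⊖ y` and
  -- `y`.
  ⊑⇒⊑⊖[⊖] : ∀ {x y} → y ⊑ x → y ⊑ x ⊖ (x ⊖ y)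
  ⊑⇒⊑⊖[⊖] {x} {y} y⊑x = ⊑-trans (⊑∼⇒⊑[⊕]⊖ y⊑∼[x⊖y])
    (⊖-monoˡ (x ⊖ y) (⊑-trans (⊑-reflexive (comm _ _)) (⊑⊖⇒⊕⊑ y⊑x ⊑-refl)))
    where
    y⊑∼[x⊖y] : y ⊑ ∼ (x ⊖ y)
    y⊑∼[x⊖y] = ∼ x , trans (comm _ _)
      (trans (⊕-congˡ (sym (∼-involutive y))) (sym (∼-involutive _)))

  -- Used with `v`, `u`, `w` the values of `f b`, `f c`, `f a` at one index. Two adjunction moves
  -- reduce it to `v ⊑ w ⊕ (e ⊕ (u ⊖ w))`.
  ⊖-transfer : ∀ {d e u v w} → v ⊑ u ⊕ e → d ⊑ v ⊖ w → d ⊖ e ⊑ u ⊖ w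
  ⊖-transfer {d} {e} {u} {v} {w} v⊑u⊕e d⊑v⊖w = ⊑⊕⇒⊖⊑ (⊑-trans d⊑v⊖w (⊑⊕⇒⊖⊑
    (⊑-trans v⊑u⊕e (⊑-trans (⊕-monoˡ e (x⊑y⊕[x⊖y] u w))
      (⊑-reflexive (trans (assoc _ _ _) (⊕-congˡ (comm _ _))))))))

module ApproximationProperties {c ℓ} (em : ExcludedMiddle (c ⊔ ℓ)) (𝕄 : CompleteMVChain c ℓ) where
  open CompleteMVChain 𝕄
  open MVAlgebraProperties mvAlgebra
  open Residuation mvAlgebra
  open Approximation em 𝕄
  open Extrema ⊑-totalOrder using (max≤v⁺; max<v⁺; xs≤max; min≤xs; v≤min⁺)

  ⊏⇒⋢ : ∀ {x y} → x ⊏ y → ¬ y ⊑ x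
  ⊏⇒⋢ (x⊑y , x≉y) y⊑x = x≉y (⊑-antisym x⊑y y⊑x)

  ⋢⇒⊏ : ∀ {x y} → ¬ y ⊑ x → x ⊏ y
  ⋢⇒⊏ {x} {y} y⋢x with ⊑-total x y
  ... | inj₁ x⊑y = x⊑y , y⋢x ∘ ⊑-reflexive ∘ sym
  ... | inj₂ y⊑x = contradiction y⊑x y⋢x

  -- `on` branches on a Boolean `lookup`; this recovers the membership proofs, with a motive over
  -- the resulting value.
  on-elim : ∀ {p n} (P : Carrier → Set p) {θ} (Y′ : Subset n) y →
            (y ∈ Y′ → P θ) → (y ∉ Y′ → P 0#) → P ((θ on Y′) y)
  on-elim P Y′ y inside outside with lookup Y′ y in eq
  ... | true  = inside (lookup⇒[]= y Y′ eq)
  ... | false = outside λ y∈ → contradiction (≡.trans (≡.sym eq) ([]=⇒lookup y∈)) λ ()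

  module _ {n} {a : Vector Carrier n} where

    -- Where `a` is `1#` every difference with it is `0#`, so a positive increase can only occur in
    -- `Y[ a ]`.
    ⊖≉0⇒∈Y : ∀ {δ x y} → 0# ⊏ δ → δ ⊑ x ⊖ a y → y ∈ Y[ a ]
    ⊖≉0⇒∈Y {x = x} 0⊏δ δ⊑ = ∈-fromDec⁺ (λ y → ¬? (a y ≈? 1#)) λ ay≈1 →
      ⊏⇒⋢ 0⊏δ (⊑-trans δ⊑ (⊑-reflexive (⊑⇒⊖≈0 (1# , trans (⊕-zeroʳ x) (sym ay≈1)))))

    γ⁺ : ∀ {δ b y} → y ∈ Y[ a ] → δ ⊑ b y ⊖ a y → y ∈ γ a δ b
    γ⁺ y∈ δ⊑ = ∈-fromDec⁺ (InGamma? a _ _) (y∈ , δ⊑)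

    γ⁻ : ∀ {δ b y} → y ∈ γ a δ b → y ∈ Y[ a ] × δ ⊑ b y ⊖ a y
    γ⁻ = ∈-fromDec⁻ (InGamma? a _ _)

    δ[]⊑∼ : ∀ {y} → y ∈ Y[ a ] → δ[ a ] ⊑ ∼ a y
    δ[]⊑∼ {y} y∈ = All.lookup (min≤xs 1# (List.map (λ i → ∼ a i) (elements Y[ a ])))
      (List.∈-map⁺ (λ i → ∼ a i) (List.∈-filter⁺ (_∈? Y[ a ]) (List.∈-allFin y) y∈))

    -- Positivity of `δ` excludes the indices outside `Y′`; `δ ⊑ δ[ a ]` prevents truncation on
    -- `Y′`, so the full increase `δ` is seen there.
    γ-α : ∀ {δ} {Y′ : Subset n} → 0# ⊏ δ → δ ⊑ δ[ a ] → Y′ ⊆ Y[ a ] → γ a δ (α a δ Y′) ≡ Y′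
    γ-α {δ} {Y′} 0⊏δ δ⊑δ[a] Y′⊆ = ⊆-antisym to from
      where
      to : γ a δ (α a δ Y′) ⊆ Y′
      to {y} y∈ = on-elim (λ v → δ ⊑ (a y ⊕ v) ⊖ a y → y ∈ Y′) Y′ y
        (λ y∈Y′ _ → y∈Y′)
        (λ _ δ⊑ → contradiction (⊑-trans δ⊑ (⊑⊕⇒⊖⊑ ⊑-refl)) (⊏⇒⋢ 0⊏δ))
        (proj₂ (γ⁻ y∈))

      from : Y′ ⊆ γ a δ (α a δ Y′)
      from {y} y∈ = γ⁺ (Y′⊆ y∈) (on-elim (λ v → δ ⊑ (a y ⊕ v) ⊖ a y) Y′ y
        (λ _ → ⊑∼⇒⊑[⊕]⊖ (⊑-trans δ⊑δ[a] (δ[]⊑∼ (Y′⊆ y∈))))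
        (contradiction y∈))

    α-γ : ∀ {δ b} → a ⊑̇ b → α a δ (γ a δ b) ⊑̇ b
    α-γ {δ} {b} a⊑b y = on-elim (λ v → a y ⊕ v ⊑ b y) (γ a δ b) y
      (λ y∈ → ⊑⊖⇒⊕⊑ (a⊑b y) (proj₂ (γ⁻ y∈)))
      (λ _ → ⊑-trans (⊑-reflexive (identityʳ _)) (a⊑b y))

    α∈[a,a⊕δ] : ∀ {δ} (Y′ : Subset n) → α a δ Y′ ∈[ a , a ⊕̇ const δ ]
    α∈[a,a⊕δ] {δ} Y′ = (λ y → x⊑x⊕y _ _) ,
      λ y → ⊕-monoʳ (a y) (on-elim (_⊑ δ) Y′ y (λ _ → ⊑-refl) (λ _ → 0⊑ δ))

    module _ {δ b} (0⊏δ : 0# ⊏ δ) (b⊑a⊕δ : b ⊑̇ a ⊕̇ const δ) where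
      private
        Y′ = γ a δ b

        -- The value `0#` on `Y′` is neutral for the maximum, so the norm only measures indices
        -- outside `Y′`.
        outsideIncrease : Vector Carrier n
        outsideIncrease y with y ∈? Y′
        ... | yes _ = 0#
        ... | no  _ = b y ⊖ a y

      largestOutside : Carrier
      largestOutside = ‖ outsideIncrease ‖

      -- Strictness survives because the maximum is over finitely many values; totality makes each
      -- failure of `δ ⊑ b y ⊖ a y` strict, and `0⊏δ` covers the default `0#` of the norm.
      largestOutside⊏δ : largestOutside ⊏ δ
      largestOutside⊏δ = max<v⁺ 0⊏δ (All.tabulate⁺ bound)
        where
        bound : ∀ y → outsideIncrease y ⊏ δ
        bound y with y ∈? Y′
        ... | yes _  = 0⊏δ
        ... | no  y∉ = ⋢⇒⊏ λ δ⊑ → y∉ (γ⁺ (⊖≉0⇒∈Y 0⊏δ δ⊑) δ⊑)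

      ⊖⊑largestOutside : ∀ {y} → y ∉ Y′ → b y ⊖ a y ⊑ largestOutside
      ⊖⊑largestOutside {y} y∉ =
        ⊑-trans at-y (All.tabulate⁻ (xs≤max 0# (List.tabulate outsideIncrease)) y)
        where
        at-y : b y ⊖ a y ⊑ outsideIncrease y
        at-y with y ∈? Y′
        ... | yes y∈ = contradiction y∈ y∉
        ... | no  _  = ⊑-refl

      -- Write `e` for `largestOutside`. On `Y′` the bound follows from `δ ⊑ (δ ⊖ e) ⊕ e`; elsewhere
      -- `e` alone bounds the increase.
      ⊑α⊕largestOutside : b ⊑̇ α a (δ ⊖ largestOutside) Y′ ⊕̇ const largestOutside
      ⊑α⊕largestOutside y = on-elim (λ v → b y ⊑ (a y ⊕ v) ⊕ e) Y′ y
        (λ _ → ⊑-trans (b⊑a⊕δ y) (⊑-trans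
          (⊕-monoʳ (a y) (⊑-trans (x⊑y⊕[x⊖y] δ e) (⊑-reflexive (comm _ _))))
          (⊑-reflexive (sym (assoc _ _ _)))))
        (λ y∉ → ⊑-trans (⊖⊑⇒⊑⊕ (⊖⊑largestOutside y∉))
          (⊑-reflexive (⊕-congʳ (sym (identityʳ _)))))
        where e = largestOutside

  module _ {m n} {f : Vector Carrier m → Vector Carrier n} (f-nonExp : NonExpansive f) where

    nonExpansive-shift : ∀ {b c e} → b ⊑̇ c ⊕̇ const e → f b ⊑̇ f c ⊕̇ const e
    nonExpansive-shift {b} {c} {e} b⊑c⊕e z = ⊖⊑⇒⊑⊕
      (⊑-trans (All.tabulate⁻ (xs≤max 0# (List.tabulate (f b ⊖̇ f c))) z)
        (⊑-trans (f-nonExp c b)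
          -- `0⊑ e` handles the initial value `0#` of the norm.
          (max≤v⁺ (0⊑ e) (All.tabulate⁺ (λ y → ⊑⊕⇒⊖⊑ (b⊑c⊕e y))))))

    module _ (a : Vector Carrier m) where

      -- Lowering the level costs at most `θ′ ⊖ θ` of the increase `θ′`, and `θ′ ⊖ (θ′ ⊖ θ)` still
      -- dominates `θ`.
      approxAt-antitone : ∀ {θ θ′} (Y′ : Subset m) → θ ⊑ θ′ → approxAt f a θ′ Y′ ⊆ approxAt f a θ Y′
      approxAt-antitone {θ} {θ′} Y′ θ⊑θ′ {z} z∈ = γ⁺ (proj₁ (γ⁻ z∈))
        (⊑-trans (⊑⇒⊑⊖[⊖] θ⊑θ′) (⊖-transfer (nonExpansive-shift α⊑α⊕ z) (proj₂ (γ⁻ z∈))))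
        where
        -- The two values of `on` must be analysed together.
        α⊑α⊕ : α a θ′ Y′ ⊑̇ α a θ Y′ ⊕̇ const (θ′ ⊖ θ)
        α⊑α⊕ y with lookup Y′ y
        ... | true  = ⊑-trans (⊕-monoʳ (a y) (x⊑y⊕[x⊖y] θ′ θ)) (⊑-reflexive (sym (assoc _ _ _)))
        ... | false = x⊑x⊕y _ _

      private
        arguments : List.List (Subset m × Fin n)
        arguments = List.cartesianProduct
          (List.filter (_⊆? Y[ a ]) (subsets m)) (elements Y[ f a ])

        values : List.List Carrier
        values = List.map (uncurry (ιAt f a)) arguments

        ∈arguments⁺ : ∀ {Y′ z} → Y′ ⊆ Y[ a ] → z ∈ Y[ f a ] → (Y′ , z) List.∈ arguments
        ∈arguments⁺ {Y′} {z} Y′⊆ z∈ = List.∈-cartesianProduct⁺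
          (List.∈-filter⁺ (_⊆? Y[ a ]) (∈-subsets Y′) Y′⊆)
          (List.∈-filter⁺ (_∈? Y[ f a ]) (List.∈-allFin z) z∈)

        ∈arguments⁻ : ∀ {Y′ z} → (Y′ , z) List.∈ arguments → Y′ ⊆ Y[ a ] × z ∈ Y[ f a ]
        ∈arguments⁻ p∈
          with List.∈-cartesianProduct⁻ (List.filter (_⊆? Y[ a ]) (subsets m)) (elements Y[ f a ]) p∈
        ... | Y′∈ , z∈ =
          proj₂ (List.∈-filter⁻ (_⊆? Y[ a ]) {xs = subsets m} Y′∈) ,
          proj₂ (List.∈-filter⁻ (_∈? Y[ f a ]) {xs = List.allFin n} z∈)

        ≉0? = λ θ → ¬? (θ ≈? 0#)

      ι⊑ιAt : ∀ Y′ {z} → Y′ ⊆ Y[ a ] → z ∈ Y[ f a ] → ¬ ιAt f a Y′ z ≈ 0# → ι f a ⊑ ιAt f a Y′ z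
      ι⊑ιAt Y′ Y′⊆ z∈ ιAt≉0 = All.lookup (min≤xs δ[ a ] (List.filter ≉0? values))
        (List.∈-filter⁺ ≉0? {xs = values}
          (List.∈-map⁺ (uncurry (ιAt f a)) {xs = arguments} (∈arguments⁺ Y′⊆ z∈)) ιAt≉0)

      ⊑ι⁺ : ∀ {x} → x ⊑ δ[ a ] →
            (∀ Y′ {z} → Y′ ⊆ Y[ a ] → z ∈ Y[ f a ] → ¬ ιAt f a Y′ z ≈ 0# → x ⊑ ιAt f a Y′ z) →
            x ⊑ ι f a
      ⊑ι⁺ {x} x⊑δ[a] x⊑ιAt = v≤min⁺ {xs = List.filter ≉0? values} x⊑δ[a] (All.tabulate bound)
        where
        bound : ∀ {v} → v List.∈ List.filter ≉0? values → x ⊑ v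
        bound v∈ with List.∈-filter⁻ ≉0? {xs = values} v∈
        ... | v∈values , v≉0 with List.∈-map⁻ (uncurry (ιAt f a)) {xs = arguments} v∈values
        ... | (Y′ , _) , p∈ , ≡.refl = x⊑ιAt Y′ (proj₁ (∈arguments⁻ p∈)) (proj₂ (∈arguments⁻ p∈)) v≉0

      ⊑ιAt : ∀ {θ} Y′ {z} → z ∈ approxAt f a θ Y′ → θ ⊑ ιAt f a Y′ z
      ⊑ιAt {θ} Y′ z∈ = proj₂ (ιAt-isMaximum f-nonExp a Y′ (proj₁ (γ⁻ {b = f (α a θ Y′)} z∈))) (lift z∈)

      -- The maximum `ιAt f a Y′ z` is attained, so `z` is present at that level; being non-zero it
      -- bounds `ι f a`, and antitonicity descends to `ι f a`.
      ∈approx : ∀ Y′ {z} → Y′ ⊆ Y[ a ] → z ∈ Y[ f a ] → ¬ ιAt f a Y′ z ≈ 0# → z ∈ approx f a Y′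
      ∈approx Y′ Y′⊆ z∈ ιAt≉0 = approxAt-antitone Y′ (ι⊑ιAt Y′ Y′⊆ z∈ ιAt≉0)
        (lower (proj₁ (ιAt-isMaximum f-nonExp a Y′ z∈)))

      γ∘f⊆approx∘γ : ∀ {δ b} → 0# ⊏ δ → b ⊑̇ a ⊕̇ const δ → γ (f a) δ (f b) ⊆ approx f a (γ a δ b)
      γ∘f⊆approx∘γ {δ} {b} 0⊏δ b⊑a⊕δ {z} z∈ = ∈approx (γ a δ b) (proj₁ ∘ γ⁻) z∈Y ιAt≉0
        where
        z∈Y : z ∈ Y[ f a ]
        z∈Y = proj₁ (γ⁻ z∈)

        -- The level `δ ⊖ e` is the part of `δ` left after discarding all increase outside
        -- `γ a δ b`; it is non-zero since `e ⊏ δ`.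
        e = largestOutside 0⊏δ b⊑a⊕δ

        δ⊖e⊑ιAt : δ ⊖ e ⊑ ιAt f a (γ a δ b) z
        δ⊖e⊑ιAt = ⊑ιAt (γ a δ b) (γ⁺ {b = f (α a (δ ⊖ e) (γ a δ b))} z∈Y
          (⊖-transfer (nonExpansive-shift (⊑α⊕largestOutside 0⊏δ b⊑a⊕δ) z) (proj₂ (γ⁻ z∈))))

        ιAt≉0 : ¬ ιAt f a (γ a δ b) z ≈ 0#
        ιAt≉0 ιAt≈0 = ⊏⇒⋢ (largestOutside⊏δ 0⊏δ b⊑a⊕δ)
          (⊖⊑0⇒⊑ (⊑-trans δ⊖e⊑ιAt (⊑-reflexive ιAt≈0)))

      -- Antitonicity descends from level `ι f a` to `δ`; there `α a δ (γ a δ b) ⊑̇ b` and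
      -- monotonicity of `f` finish.
      approx∘γ⊆γ∘f : ∀ {δ b} → δ ⊑ ι f a → a ⊑̇ b → approx f a (γ a δ b) ⊆ γ (f a) δ (f b)
      approx∘γ⊆γ∘f {δ} {b} δ⊑ι a⊑b {z} z∈ = γ⁺ (proj₁ (γ⁻ z∈δ))
        (⊑-trans (proj₂ (γ⁻ z∈δ)) (⊖-monoˡ (f a z) (nonExpansive⇒monotone f-nonExp (α-γ a⊑b) z)))
        where
        z∈δ : z ∈ approxAt f a δ (γ a δ b)
        z∈δ = approxAt-antitone (γ a δ b) δ⊑ι z∈

      -- At `b = α a δ Y′` the equality, with `γ-α`, identifies `approxAt f a δ Y′` with
      -- `approx f a Y′`. The latter contains every `z` with non-zero `ιAt f a Y′ z`, so maximality
      -- gives `δ ⊑ ιAt f a Y′ z`.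
      γ∘f≡approx∘γ⇒⊑ι : ∀ {δ} → 0# ⊏ δ → δ ⊑ δ[ a ] →
        (∀ b → b ∈[ a , a ⊕̇ const δ ] → γ (f a) δ (f b) ≡ approx f a (γ a δ b)) → δ ⊑ ι f a
      γ∘f≡approx∘γ⇒⊑ι {δ} 0⊏δ δ⊑δ[a] eq = ⊑ι⁺ δ⊑δ[a] λ Y′ {z} Y′⊆ z∈ ιAt≉0 →
        ⊑ιAt Y′ (≡.subst (z ∈_)
          (≡.sym (≡.trans (eq (α a δ Y′) (α∈[a,a⊕δ] Y′)) (≡.cong (approx f a) (γ-α 0⊏δ δ⊑δ[a] Y′⊆))))
          (∈approx Y′ Y′⊆ z∈ ιAt≉0))

theorem3p14 : ∀ {c ℓ} (em : ExcludedMiddle (c ⊔ ℓ)) (𝕄 : CompleteMVChain c ℓ) →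
    let open CompleteMVChain 𝕄
        open Approximation em 𝕄
    in
    ∀ {m n : ℕ} (f : Vector Carrier m → Vector Carrier n) → NonExpansive f →
    (a : Vector Carrier m) (δ : Carrier) → 0# ⊏ δ →
    (∀ b → b ∈[ a , a ⊕̇ const δ ] → γ (f a) δ (f b) ⊆ approx f a (γ a δ b))
    × (δ ⊑ δ[ a ] →
        (δ ⊑ ι f a) ⇔ (∀ b → b ∈[ a , a ⊕̇ const δ ] → γ (f a) δ (f b) ≡ approx f a (γ a δ b)))
theorem3p14 em 𝕄 f f-nonExp a δ 0⊏δ =
  (λ b b∈ → γ∘f⊆approx∘γ f-nonExp a 0⊏δ (proj₂ b∈)) ,
  λ δ⊑δ[a] → mk⇔
    (λ δ⊑ι b b∈ → ⊆-antisym (γ∘f⊆approx∘γ f-nonExp a 0⊏δ (proj₂ b∈))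
                             (approx∘γ⊆γ∘f f-nonExp a δ⊑ι (proj₁ b∈)))
    (γ∘f≡approx∘γ⇒⊑ι f-nonExp a 0⊏δ δ⊑δ[a])
  where open ApproximationProperties em 𝕄
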